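{- Let $n\geq 7$ be an integer and let $G$ be an edge-colored $K^{(3)}_n$ containing no rainbow copy of the messy path $\mathcal{M}$. Then $|C(G)|\leq 2$.
   Context: An edge-coloring of a hypergraph $G$ is any map $c:E(G)\to\mathbb{N}$ (not necessarily proper); $C(G)=\{c(e):e\in E(G)\}$. A copy of $H$ in $G$ is a subhypergraph isomorphic to $H$; it is rainbow if its edges have pairwise distinct colors. $K^{(3)}_n$ is the complete 3-uniform hypergraph on $n$ vertices. The messy path $\mathcal{M}$ is the 3-graph with vertices $v_1,\ldots,v_6$ and edges $\{v_1v_2v_3, v_2v_3v_4, v_4v_5v_6\}$. -}

module Defs where

open import Data.Nat using (ℕ)
open import Data.Fin using (Fin; zero; suc)
open import Data.Product using (_×_; ∃-syntax)
open import Data.Sum using (_⊎_)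
open import Relation.Binary.PropositionalEquality using (_≡_; _≢_)
open import Function.Definitions using (Injective)

-- Vertices of K^(3)_n are Fin n; its edges are the 3-element subsets {x,y,z}.
-- An edge-colouring c : E(K^(3)_n) → ℕ is represented by a function on triples
-- that is symmetric (invariant under permuting its arguments); only its values
-- on triples of pairwise distinct vertices matter (these are the edges).
record Colouring (n : ℕ) : Set where
  field
    col    : Fin n → Fin n → Fin n → ℕ
    swap₁₂ : ∀ x y z → col x y z ≡ col y x z
    swap₂₃ : ∀ x y z → col x y z ≡ col x z y
open Colouring public

Distinct3 : {n : ℕ} → Fin n → Fin n → Fin n → Set
Distinct3 x y z = x ≢ y × x ≢ z × y ≢ z

v₁ v₂ v₃ v₄ v₅ v₆ : Fin 6
v₁ = zero
v₂ = suc zero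
v₃ = suc (suc zero)
v₄ = suc (suc (suc zero))
v₅ = suc (suc (suc (suc zero)))
v₆ = suc (suc (suc (suc (suc zero))))

RainbowMessyPath : {n : ℕ} → Colouring n → (Fin 6 → Fin n) → Set
RainbowMessyPath c φ =
  let e₁ = col c (φ v₁) (φ v₂) (φ v₃)
      e₂ = col c (φ v₂) (φ v₃) (φ v₄)
      e₃ = col c (φ v₄) (φ v₅) (φ v₆)
  in e₁ ≢ e₂ × e₁ ≢ e₃ × e₂ ≢ e₃

HasRainbowMessyPath : {n : ℕ} → Colouring n → Set
HasRainbowMessyPath {n} c =
  ∃[ φ ] (Injective _≡_ _≡_ φ × RainbowMessyPath c φ)

AtMostTwoColours : {n : ℕ} → Colouring n → Set
AtMostTwoColours c =
  ∃[ a ] ∃[ b ] (∀ x y z → Distinct3 x y z → col c x y z ≡ a ⊎ col c x y z ≡ b)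

{-# OPTIONS --safe #-}
-- Call two edges xyz, yzw of different colours a tight pair.  If there is none,
-- the colouring is constant, because any two edges are joined by a walk that
-- replaces one vertex at a time.  Otherwise no edge e has a third colour: the
-- two edges and e lie on seven vertices a, b, c, x, y, z, w, and up to the
-- symmetries x ↔ w, y ↔ z and permutations of a, b, c the edge e is abw (a messy
-- path), ayz, aby, abc, axy, axw or xyw.  In each case the patterns already
-- excluded leave no colour for some further edge.

module Submission where

open import Defs
open import Data.Nat using (ℕ; _≤_; _<_)
import Data.Nat as ℕ
open import Data.Nat.Properties using (<⇒≱; m+n≤o⇒n≤o)
open import Data.Fin using (Fin; _≟_; _≤?_; inject≤)
open import Data.Fin.Patterns
open import Data.Fin.Properties using (any?; all?; ¬∀⟶∃¬; injective⇒≤; inject≤-injective)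
open import Data.Product using (_×_; _,_; ∃; ∃-syntax)
open import Data.Product.Properties using (≡-dec)
open import Data.Sum using (_⊎_; inj₁; inj₂)
open import Data.List using (List; []; _∷_; _++_; map)
open import Data.List.Relation.Unary.All as All using (All; []; _∷_)
open import Data.List.Relation.Unary.All.Properties using (map⁺; ++⁺)
open import Data.List.Relation.Unary.Any as ListAny using (Any)
open import Data.Vec using (Vec; []; _∷_; lookup)
open import Data.Vec.Membership.Propositional using (_∈_; _∉_)
import Data.Vec.Membership.DecPropositional as DecMembership
open import Data.Vec.Relation.Unary.Any using (here; there; index)
open import Data.Vec.Relation.Unary.Any.Properties using (lookup-index)
open import Data.Vec.Relation.Unary.All.Properties using (lookup⁻)
open import Data.Vec.Membership.Propositional.Properties using (∈-lookup)
open import Data.Vec.Relation.Unary.All using ([]; _∷_)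
open import Data.Vec.Relation.Unary.AllPairs using (allPairs?; []; _∷_)
open import Data.Vec.Relation.Unary.Unique.Propositional using (Unique)
open import Data.Vec.Relation.Unary.Unique.Propositional.Properties using (lookup-injective)
open import Function using (_∘_)
open import Function.Definitions using (Injective)
open import Relation.Binary.PropositionalEquality
  using (_≡_; _≢_; refl; sym; trans; cong; ≢-sym)
open import Relation.Nullary using (¬_; Dec; yes; no; contradiction)
open import Relation.Nullary.Decidable using (True; toWitness; decidable-stable; from-yes; ¬?; _→-dec_; _×-dec_)
open import Data.Empty using (⊥)

-- Colours left open by excluded rainbow triples.

Rainbow : ℕ → ℕ → ℕ → Set
Rainbow p q r = p ≢ q × p ≢ r × q ≢ r

rainbow-cong : ∀ {p p′ q q′ r r′} → p ≡ p′ → q ≡ q′ → r ≡ r′ → Rainbow p q r → Rainbow p′ q′ r′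
rainbow-cong refl refl refl R = R

module _ {p q r : ℕ} where

  swap : ¬ Rainbow p q r → ¬ Rainbow q p r
  swap ¬R (q≢p , q≢r , p≢r) = ¬R (≢-sym q≢p , p≢r , q≢r)

  rotate : ¬ Rainbow p q r → ¬ Rainbow r p q
  rotate ¬R (r≢p , r≢q , p≢q) = ¬R (p≢q , ≢-sym r≢p , ≢-sym r≢q)

  oneOf : p ≢ q → ¬ Rainbow p q r → r ≡ p ⊎ r ≡ q
  oneOf p≢q ¬R with r ℕ.≟ p | r ℕ.≟ q
  ... | yes r≡p | _ = inj₁ r≡p
  ... | no _ | yes r≡q = inj₂ r≡q
  ... | no r≢p | no r≢q = contradiction (p≢q , ≢-sym r≢p , ≢-sym r≢q) ¬R

  -- Each excluded triple confines `v` to two colours, `p` or `q` and then `q` or `r`; only `q` is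
  -- common.
  forced : ∀ {v} → Rainbow p q r → ¬ Rainbow p q v → ¬ Rainbow q r v → v ≡ q
  forced {v} (p≢q , p≢r , q≢r) ¬pqv ¬qrv with v ℕ.≟ q
  ... | yes v≡q = v≡q
  ... | no v≢q with v ℕ.≟ p
  ...   | yes refl = contradiction (q≢r , ≢-sym v≢q , ≢-sym p≢r) ¬qrv
  ...   | no v≢p = contradiction (p≢q , ≢-sym v≢p , ≢-sym v≢q) ¬pqv

  noColour : ∀ {v} → Rainbow p q r →
    ¬ Rainbow p q v → ¬ Rainbow p r v → ¬ Rainbow q r v → ⊥
  noColour R@(p≢q , p≢r , q≢r) ¬pqv ¬prv ¬qrv with refl ← forced R ¬pqv ¬qrv =
    ¬prv (p≢r , p≢q , ≢-sym q≢r)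

  -- Once `u` is forced to be `q`, the exclusion of `p`, `u`, `v` becomes the one that `noColour`
  -- still lacks.
  squeeze : ∀ {u v} → Rainbow p q r → ¬ Rainbow p q u → ¬ Rainbow q r u →
    ¬ Rainbow p u v → ¬ Rainbow p r v → ¬ Rainbow q r v → ⊥
  squeeze R ¬pqu ¬qru ¬puv ¬prv ¬qrv with refl ← forced R ¬pqu ¬qru =
    noColour R ¬puv ¬prv ¬qrv

-- Triples on seven labelled vertices.

Edge : Set
Edge = Fin 7 × Fin 7 × Fin 7

pattern a = 0F
pattern b = 1F
pattern c = 2F
pattern x = 3F
pattern y = 4F
pattern z = 5F
pattern w = 6F

-- A sorting network as normal form: two triples name the same edge exactly when their sorted forms
-- agree, which computation can decide.
sort₁₂ sort₂₃ sort : Edge → Edge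
sort₁₂ (i , j , k) with i ≤? j
... | yes _ = i , j , k
... | no _ = j , i , k
sort₂₃ (i , j , k) with j ≤? k
... | yes _ = i , j , k
... | no _ = i , k , j
sort = sort₁₂ ∘ sort₂₃ ∘ sort₁₂

rename : (Fin 7 → Fin 7) → Edge → Edge
rename σ (i , j , k) = σ i , σ j , σ k

unique? : ∀ {n m} (xs : Vec (Fin n) m) → Dec (Unique xs)
unique? = allPairs? (λ i j → ¬? (i ≟ j))

∘-lookup-injective : ∀ {n m k} {φ : Fin m → Fin n} {xs : Vec (Fin m) k} →
  Injective _≡_ _≡_ φ → Unique xs → Injective _≡_ _≡_ (φ ∘ lookup xs)
∘-lookup-injective inj unique eq = lookup-injective unique _ _ (inj eq)

closeUnder : (Fin 7 → Fin 7) → List Edge → List Edge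
closeUnder σ es = es ++ map (rename σ) es

xw yz ab bc : Vec (Fin 7) 7
xw = a ∷ b ∷ c ∷ w ∷ y ∷ z ∷ x ∷ []
yz = a ∷ b ∷ c ∷ x ∷ z ∷ y ∷ w ∷ []
ab = b ∷ a ∷ c ∷ x ∷ y ∷ z ∷ w ∷ []
bc = a ∷ c ∷ b ∷ x ∷ y ∷ z ∷ w ∷ []

-- The first two entries are the tight pair itself, listed so that the orbits exhaust all edges on
-- the seven vertices.
thirdEdges : List Edge
thirdEdges = (x , y , z) ∷ (y , z , w) ∷ (a , b , w) ∷ (a , y , z) ∷ (a , b , y) ∷
  (a , b , c) ∷ (a , x , y) ∷ (a , x , w) ∷ (x , y , w) ∷ []

-- The transpositions ab, bc, ab in turn generate all permutations of a, b, c.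
orbits : List Edge
orbits = closeUnder (lookup ab) (closeUnder (lookup bc) (closeUnder (lookup ab)
  (closeUnder (lookup yz) (closeUnder (lookup xw) thirdEdges))))

-- A finite check by evaluation, certifying that the case distinction is complete.
orbits-cover : ∀ i j k → Distinct3 i j k → Any (λ e → sort (i , j , k) ≡ sort e) orbits
orbits-cover = from-yes (all? λ i → all? λ j → all? λ k →
  (¬? (i ≟ j) ×-dec ¬? (i ≟ k) ×-dec ¬? (j ≟ k)) →-dec
  ListAny.any? (λ e → sort (i , j , k) ≟ₑ sort e) orbits)
  where _≟ₑ_ = ≡-dec _≟_ (≡-dec _≟_ _≟_)

module _ {n m : ℕ} {vs : Vec (Fin n) m} (m<n : m < n) where

  open DecMembership (_≟_ {n}) using (_∈?_)

  -- Pigeonhole: if `vs` held every vertex, positions in `vs` would inject `Fin n` into `Fin m`.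
  fresh : ∃ λ v → v ∉ vs
  fresh = ¬∀⟶∃¬ n (_∈ vs) (_∈? vs) λ all∈ →
    <⇒≱ m<n (injective⇒≤ {f = λ v → index (all∈ v)} λ {u} {v} eq →
      trans (lookup-index (all∈ u)) (trans (cong (lookup vs) eq) (sym (lookup-index (all∈ v)))))

  -- When `p` is already present a fresh vertex is added instead, so the length grows by one in
  -- either case and three calls lead from four vertices to exactly seven.
  enlarge : Unique vs → ∀ p → ∃ λ v → Unique (v ∷ vs) × p ∈ v ∷ vs
  enlarge unique p with p ∈? vs
  ... | no p∉vs = p , lookup⁻ (λ { i refl → p∉vs (∈-lookup i vs) }) ∷ unique , here refl
  ... | yes p∈vs with v , v∉vs ← fresh =
    v , lookup⁻ (λ { i refl → v∉vs (∈-lookup i vs) }) ∷ unique , there p∈vs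

-- Excluding a third colour beside a tight pair.

module _ {n : ℕ} (χ : Colouring n) where

  hue : (Fin 7 → Fin n) → Edge → ℕ
  hue φ (i , j , k) = col χ (φ i) (φ j) (φ k)

  module _ (φ : Fin 7 → Fin n) where

    hue-sort₁₂ : ∀ e → hue φ (sort₁₂ e) ≡ hue φ e
    hue-sort₁₂ (i , j , k) with i ≤? j
    ... | yes _ = refl
    ... | no _ = swap₁₂ χ _ _ _

    hue-sort₂₃ : ∀ e → hue φ (sort₂₃ e) ≡ hue φ e
    hue-sort₂₃ (i , j , k) with j ≤? k
    ... | yes _ = refl
    ... | no _ = swap₂₃ χ _ _ _

    hue-sort : ∀ e → hue φ (sort e) ≡ hue φ e
    hue-sort e = trans (hue-sort₁₂ (sort₂₃ (sort₁₂ e)))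
                (trans (hue-sort₂₃ (sort₁₂ e)) (hue-sort₁₂ e))

    hue-resp-sort : ∀ {d e} → sort d ≡ sort e → hue φ d ≡ hue φ e
    hue-resp-sort {d} {e} eq = trans (sym (hue-sort d)) (trans (cong (hue φ) eq) (hue-sort e))

  RainbowEdges : (Fin 7 → Fin n) → Edge → Edge → Edge → Set
  RainbowEdges φ d e f = Rainbow (hue φ d) (hue φ e) (hue φ f)

  -- Quantifying over every injective `φ` lets one exclusion be reused under any renaming of the
  -- seven vertices.
  Avoids : Edge → Set
  Avoids e = ∀ φ → Injective _≡_ _≡_ φ → ¬ RainbowEdges φ (x , y , z) (y , z , w) e

  -- With σ concrete, sorting makes each edge a literal increasing triple, so that
  -- exclusions under different renamings mention definitionally equal colours.
  at : ∀ {e} → Avoids e → ∀ φ → Injective _≡_ _≡_ φ →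
    (xs : Vec (Fin 7) 7) {_ : True (unique? xs)} → let σ = lookup xs in
    ¬ RainbowEdges φ (sort (rename σ (x , y , z))) (sort (rename σ (y , z , w))) (sort (rename σ e))
  at {e} avoids φ inj xs {u} R = avoids (φ ∘ σ) (∘-lookup-injective {φ = φ} inj (toWitness u))
    (rainbow-cong (hue-sort φ (rename σ (x , y , z))) (hue-sort φ (rename σ (y , z , w)))
      (hue-sort φ (rename σ e)) R)
    where σ = lookup xs

  -- An exclusion of `e` read along `φ ∘ σ` is one of `rename σ e`, provided `σ` keeps the colours
  -- of the tight pair up to order. The double negation suits `swap`, which acts on refutations.
  closeUnder⁺ : ∀ (xs : Vec (Fin 7) 7) {_ : True (unique? xs)} → let σ = lookup xs in
    (∀ φ {p} → Rainbow (hue φ (x , y , z)) (hue φ (y , z , w)) p →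
      ¬ ¬ Rainbow (hue φ (rename σ (x , y , z))) (hue φ (rename σ (y , z , w))) p) →
    ∀ {es} → All Avoids es → All Avoids (closeUnder σ es)
  closeUnder⁺ xs {u} preserves avoid = ++⁺ avoid (map⁺ (All.map moved avoid))
    where
    moved : ∀ {e} → Avoids e → Avoids (rename (lookup xs) e)
    moved avoids φ inj R = preserves φ R
      (avoids (φ ∘ lookup xs) (∘-lookup-injective {φ = φ} inj (toWitness u)))

  avoids-member : ∀ {d es} → All Avoids es → Any (λ e → sort d ≡ sort e) es → Avoids d
  avoids-member avoid d∈es φ inj R =
    let avoids , eq = All.lookupAny avoid d∈es
    in avoids φ inj (rainbow-cong refl refl (hue-resp-sort φ eq) R)

  module _ (noPath : ¬ HasRainbowMessyPath χ) where

    avoids-abw : Avoids (a , b , w)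
    avoids-abw φ inj R = noPath (φ ∘ lookup path ,
      ∘-lookup-injective {φ = φ} inj (from-yes (unique? path)) ,
      rainbow-cong refl refl (hue-sort φ (w , a , b)) R)
      where path = x ∷ y ∷ z ∷ w ∷ a ∷ b ∷ []

    -- bcw is forced to the colour of yzw; then cxw has no colour.
    avoids-ayz : Avoids (a , y , z)
    avoids-ayz φ inj R = squeeze R
      (M (b ∷ c ∷ a ∷ x ∷ y ∷ z ∷ w ∷ []))
      (swap (M (b ∷ c ∷ x ∷ a ∷ y ∷ z ∷ w ∷ [])))
      (rotate (M (y ∷ z ∷ a ∷ b ∷ c ∷ w ∷ x ∷ [])))
      (swap (M (c ∷ w ∷ b ∷ a ∷ y ∷ z ∷ x ∷ [])))
      (swap (M (c ∷ x ∷ b ∷ a ∷ y ∷ z ∷ w ∷ [])))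
      where M = at avoids-abw φ inj

    -- abx is forced to the colour of yzw; then abc has no colour.
    avoids-aby : Avoids (a , b , y)
    avoids-aby φ inj R = squeeze R
      (swap (M (a ∷ b ∷ c ∷ w ∷ y ∷ z ∷ x ∷ [])))
      (rotate (swap (M (z ∷ w ∷ c ∷ x ∷ a ∷ b ∷ y ∷ []))))
      (rotate (swap (M (y ∷ z ∷ w ∷ c ∷ a ∷ b ∷ x ∷ []))))
      (rotate (swap (M (x ∷ z ∷ w ∷ c ∷ a ∷ b ∷ y ∷ []))))
      (rotate (swap (M (z ∷ w ∷ x ∷ c ∷ a ∷ b ∷ y ∷ []))))
      where M = at avoids-abw φ inj

    -- abz has no colour.
    avoids-abc : Avoids (a , b , c)
    avoids-abc φ inj R = noColour R
      (at avoids-aby φ inj (a ∷ b ∷ c ∷ x ∷ z ∷ y ∷ w ∷ []))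
      (rotate (M (x ∷ y ∷ w ∷ c ∷ a ∷ b ∷ z ∷ [])))
      (rotate (M (y ∷ w ∷ x ∷ c ∷ a ∷ b ∷ z ∷ [])))
      where M = at avoids-abw φ inj

    -- bxy is forced to the colour of axy; then acx has no colour.
    avoids-axy : Avoids (a , x , y)
    avoids-axy φ inj (p≢q , p≢r , q≢r) = squeeze (p≢r , p≢q , ≢-sym q≢r)
      (at avoids-ayz φ inj (b ∷ c ∷ w ∷ z ∷ x ∷ y ∷ a ∷ []))
      (swap (rotate (B (z ∷ w ∷ c ∷ a ∷ y ∷ x ∷ b ∷ []))))
      (B (a ∷ c ∷ w ∷ z ∷ x ∷ y ∷ b ∷ []))
      (swap (M (a ∷ c ∷ b ∷ w ∷ y ∷ z ∷ x ∷ [])))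
      (rotate (rotate (M (z ∷ w ∷ b ∷ c ∷ x ∷ a ∷ y ∷ []))))
      where
      M = at avoids-abw φ inj
      B = at avoids-aby φ inj

    -- abx has no colour.
    avoids-axw : Avoids (a , x , w)
    avoids-axw φ inj R = noColour R
      (swap (M (a ∷ b ∷ c ∷ w ∷ y ∷ z ∷ x ∷ [])))
      (rotate (at avoids-aby φ inj (y ∷ z ∷ c ∷ w ∷ x ∷ a ∷ b ∷ [])))
      (rotate (swap (M (y ∷ z ∷ c ∷ b ∷ x ∷ a ∷ w ∷ []))))
      where M = at avoids-abw φ inj

    -- abz has no colour.
    avoids-xyw : Avoids (x , y , w)
    avoids-xyw φ inj R = noColour R
      (at avoids-aby φ inj (a ∷ b ∷ c ∷ x ∷ z ∷ y ∷ w ∷ []))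
      (swap (M (a ∷ b ∷ c ∷ w ∷ x ∷ y ∷ z ∷ [])))
      (swap (M (a ∷ b ∷ c ∷ x ∷ y ∷ w ∷ z ∷ [])))
      where M = at avoids-abw φ inj

    avoid-orbits : All Avoids orbits
    avoid-orbits =
      -- Permuting `a`, `b`, `c` leaves both edges of the pair literally unchanged.
      closeUnder⁺ ab (λ _ R ¬R → ¬R R) (closeUnder⁺ bc (λ _ R ¬R → ¬R R)
      (closeUnder⁺ ab (λ _ R ¬R → ¬R R) (closeUnder⁺ yz yz-preserves (closeUnder⁺ xw xw-preserves
      -- For the edges of the pair itself, a third colour would have to differ from itself.
      ( (λ { _ _ (_ , p≢p , _) → p≢p refl }) ∷ (λ { _ _ (_ , _ , q≢q) → q≢q refl })
      ∷ avoids-abw ∷ avoids-ayz ∷ avoids-aby ∷ avoids-abc ∷ avoids-axy ∷ avoids-axw ∷ avoids-xyw ∷ [])))))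
      where
      yz-preserves : ∀ φ {p} → Rainbow (hue φ (x , y , z)) (hue φ (y , z , w)) p →
        ¬ ¬ Rainbow (hue φ (x , z , y)) (hue φ (z , y , w)) p
      yz-preserves φ R ¬R = ¬R (rainbow-cong
        (hue-resp-sort φ {x , y , z} {x , z , y} refl)
        (hue-resp-sort φ {y , z , w} {z , y , w} refl) refl R)

      xw-preserves : ∀ φ {p} → Rainbow (hue φ (x , y , z)) (hue φ (y , z , w)) p →
        ¬ ¬ Rainbow (hue φ (w , y , z)) (hue φ (y , z , x)) p
      xw-preserves φ R ¬R = swap ¬R (rainbow-cong
        (hue-resp-sort φ {x , y , z} {y , z , x} refl)
        (hue-resp-sort φ {y , z , w} {w , y , z} refl) refl R)

    avoids-distinct : ∀ {i j k} → Distinct3 i j k → Avoids (i , j , k)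
    avoids-distinct {i} {j} {k} i≢j≢k = avoids-member avoid-orbits (orbits-cover i j k i≢j≢k)

    module _ (7≤n : 7 ≤ n) where

      twoColours : ∀ {s t u v} → Unique (s ∷ t ∷ u ∷ v ∷ []) → col χ s t u ≢ col χ t u v →
        ∀ p q r → Distinct3 p q r → col χ p q r ≡ col χ s t u ⊎ col χ p q r ≡ col χ t u v
      twoColours unique c≢d p q r (p≢q , p≢r , q≢r) =
        -- `enlarge` prepends, so `s`, `t`, `u`, `v` end up in the slots `x`, `y`, `z`, `w`, and the
        -- added vertices fill `c`, `b`, `a` in turn.
        let _ , unique₅ , p∈₅ = enlarge (m+n≤o⇒n≤o 2 7≤n) unique p
            _ , unique₆ , q∈₆ = enlarge (m+n≤o⇒n≤o 1 7≤n) unique₅ q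
            _ , unique₇ , r∈ = enlarge 7≤n unique₆ r
        in withFrame unique₇ c≢d (there (there p∈₅)) (there q∈₆) r∈ p≢q p≢r q≢r
        where
        withFrame : ∀ {vs : Vec (Fin n) 7} {p q r} → let φ = lookup vs in
          Unique vs → hue φ (x , y , z) ≢ hue φ (y , z , w) →
          p ∈ vs → q ∈ vs → r ∈ vs → p ≢ q → p ≢ r → q ≢ r →
          col χ p q r ≡ hue φ (x , y , z) ⊎ col χ p q r ≡ hue φ (y , z , w)
        withFrame {vs} unique c≢d p∈ q∈ r∈ p≢q p≢r q≢r
          -- With `p`, `q`, `r` written as lookups, their colour is the hue of a triple of indices.
          rewrite lookup-index p∈ | lookup-index q∈ | lookup-index r∈ =
          oneOf c≢d (avoids-distinct
            (p≢q ∘ cong (lookup vs) , p≢r ∘ cong (lookup vs) , q≢r ∘ cong (lookup vs))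
            (lookup vs) (lookup-injective unique _ _))

  -- Colourings without a tight pair.

  module _ (shift : ∀ {s t u v} → Distinct3 s t u → v ≢ t → v ≢ u → col χ s t u ≡ col χ v t u) where

    rotate₃ : ∀ s t u → col χ s t u ≡ col χ u s t
    rotate₃ s t u = trans (swap₂₃ χ s t u) (swap₁₂ χ s u t)

    move₁ : ∀ {s t u} p → Distinct3 s t u →
      ∃[ t′ ] ∃[ u′ ] Distinct3 p t′ u′ × col χ s t u ≡ col χ p t′ u′
    move₁ {s} {t} {u} p d@(s≢t , s≢u , t≢u) with p ≟ t | p ≟ u
    ... | yes refl | _ = s , u , (≢-sym s≢t , t≢u , s≢u) , swap₁₂ χ s t u
    ... | no _ | yes refl = s , t , (≢-sym s≢u , ≢-sym t≢u , s≢t) , rotate₃ s t u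
    ... | no p≢t | no p≢u = t , u , (p≢t , p≢u , t≢u) , shift d p≢t p≢u

    move₂ : ∀ {p t u} q → p ≢ q → Distinct3 p t u →
      ∃[ u′ ] Distinct3 p q u′ × col χ p t u ≡ col χ p q u′
    move₂ {p} {t} {u} q p≢q (p≢t , p≢u , t≢u) with q ≟ u
    ... | yes refl = t , (p≢u , p≢t , ≢-sym t≢u) , swap₂₃ χ p t u
    -- Here `q` may equal `t`: `shift` admits `v` equal to `s`.
    ... | no q≢u = u , (p≢q , p≢u , q≢u) , trans (swap₁₂ χ p t u)
      (trans (shift (≢-sym p≢t , t≢u , p≢u) (≢-sym p≢q) q≢u) (swap₁₂ χ q p u))

    -- `p`, `q`, `r` are brought in one at a time; a vertex already in the edge is at most moved to
    -- its slot, so every intermediate triple is still an edge.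
    constant : ∀ {s t u p q r} → Distinct3 s t u → Distinct3 p q r → col χ s t u ≡ col χ p q r
    constant {p = p} {q} {r} stu (p≢q , p≢r , q≢r)
      with _ , _ , ptu , eq₁ ← move₁ p stu
      with u , (_ , p≢u , q≢u) , eq₂ ← move₂ q p≢q ptu =
      trans eq₁ (trans eq₂ (trans (rotate₃ p q u) (trans
        (shift (≢-sym p≢u , ≢-sym q≢u , p≢q) (≢-sym p≢r) (≢-sym q≢r)) (sym (rotate₃ p q r)))))

  tightPair? : Dec (∃[ s ] ∃[ t ] ∃[ u ] ∃[ v ]
    Unique (s ∷ t ∷ u ∷ v ∷ []) × col χ s t u ≢ col χ t u v)
  tightPair? = any? λ s → any? λ t → any? λ u → any? λ v →
    unique? (s ∷ t ∷ u ∷ v ∷ []) ×-dec ¬? (col χ s t u ℕ.≟ col χ t u v)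

theorem1p4 : (n : ℕ) → 7 ≤ n → (c : Colouring n) →
    ¬ HasRainbowMessyPath c → AtMostTwoColours c
theorem1p4 n 7≤n χ noPath with tightPair? χ
... | yes (s , t , u , v , unique , c≢d) =
  col χ s t u , col χ t u v , twoColours χ noPath 7≤n unique c≢d
-- The colouring is constant, so one colour serves twice; `7 ≤ n` supplies an edge to read it from.
... | no noTightPair = hue χ φ (x , y , z) , hue χ φ (x , y , z) , λ p q r pqr →
  inj₁ (constant χ shift pqr (distinct (λ ()) , distinct (λ ()) , distinct (λ ())))
  where
  φ : Fin 7 → Fin n
  φ i = inject≤ i 7≤n

  distinct : ∀ {i j} → i ≢ j → φ i ≢ φ j
  distinct i≢j = i≢j ∘ inject≤-injective 7≤n 7≤n _ _

  shift : ∀ {s t u v} → Distinct3 s t u → v ≢ t → v ≢ u → col χ s t u ≡ col χ v t u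
  shift {s} {t} {u} {v} (s≢t , s≢u , t≢u) v≢t v≢u with s ≟ v
  ... | yes refl = refl
  ... | no s≢v = trans (decidable-stable (_ ℕ.≟ _) λ c≢d → noTightPair (s , t , u , v ,
    (s≢t ∷ s≢u ∷ s≢v ∷ []) ∷ (t≢u ∷ ≢-sym v≢t ∷ []) ∷ (≢-sym v≢u ∷ []) ∷ [] ∷ [] , c≢d))
    (trans (swap₂₃ χ t u v) (swap₁₂ χ t v u))
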